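{- Let $n\geq 1$. For every graph $G$ on $n$ vertices, if the minimum degree satisfies $\delta(G)\geq \frac{2n-5}{3}$, then $\mathrm{tc}_2(G)\leq 2$.
   Context: Graphs are finite and simple. The $r$-color tree-cover number $\mathrm{tc}_r(G)$ is the minimum $s$ such that for every $r$-coloring of the edges of $G$ (an arbitrary assignment of one of $r$ colors to each edge) there exists a collection of monochromatic connected subgraphs $\{H_1,\dots,H_t\}$ with $t\leq s$ such that $V(H_1)\cup\dots\cup V(H_t)=V(G)$. (A single vertex counts as a monochromatic connected subgraph.) -}

module Defs where

open import Data.Bool.Base using (Bool; false; T)
open import Data.Bool.Properties using (T?; T-irrelevant)
open import Data.Empty using (⊥-elim)
open import Data.Fin.Base using (Fin)
open import Data.Fin.Properties as Fin using (any?; all?)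
open import Data.Fin.Subset using (Subset; ∣_∣; _∈_; ⁅_⁆; Nonempty; _∪_) renaming (⊥ to ∅)
open import Data.Fin.Subset.Properties
  using (_∈?_; anySubset?; nonempty?; x∈⁅x⁆; x∈⁅y⁆⇒x≡y; x∈p∪q⁺; x∈p∪q⁻; ∉⊥)
open import Data.List.Base using (List; []; _∷_; length; map; allFin)
open import Data.List.Extrema.Nat using (min)
open import Data.List.Membership.Propositional renaming (_∈_ to _∈ˡ_)
open import Data.List.Membership.Propositional.Properties using (∈-allFin)
open import Data.List.Properties using (length-map; length-tabulate)
open import Data.List.Relation.Unary.Any as Any using (Any; here; there)
open import Data.List.Relation.Unary.Any.Properties using (map⁺)
open import Data.Maybe.Base using (Maybe; just; nothing)
open import Data.Maybe.Properties using (just-injective; ≡-dec)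
open import Data.Nat.Base using (ℕ; zero; suc; _≤_; z≤n; s≤s)
open import Data.Nat.Properties using (≤-reflexive)
open import Data.Product.Base using (Σ; ∃; _×_; _,_; proj₁; proj₂)
open import Data.Sum.Base using (_⊎_; inj₁; inj₂; [_,_]′)
open import Data.Vec.Base using (Vec; []; _∷_; tabulate; lookup)
open import Data.Vec.Properties using (lookup∘tabulate)
open import Function.Base using (_∘_; id; case_of_)
open import Relation.Binary.Construct.Closure.ReflexiveTransitive as Star
  using (Star; ε; _◅_; _◅◅_)
open import Relation.Binary.PropositionalEquality
  using (_≡_; refl; sym; trans; cong; subst)
open import Relation.Nullary
  using (Dec; yes; no; ¬_; contradiction)
open import Relation.Nullary.Decidable
  using (map′; _×-dec_; _⊎-dec_; _→-dec_; ¬?; decidable-stable; isYes; toWitness; fromWitness)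

private
  variable
    n r : ℕ

record Graph (n : ℕ) : Set where
  field
    adj       : Fin n → Fin n → Bool
    symmetric : ∀ u v → adj u v ≡ adj v u
    loopless  : ∀ v → adj v v ≡ false

  Adj : Fin n → Fin n → Set
  Adj u v = T (adj u v)

  flip : ∀ {u v} → Adj u v → Adj v u
  flip {u} {v} = subst T (symmetric u v)

open Graph using (Adj; flip)

neighbours : Graph n → Fin n → Subset n
neighbours G v = tabulate (Graph.adj G v)

degree : Graph n → Fin n → ℕ
degree G v = ∣ neighbours G v ∣

-- `min` takes a default value; n is larger than every degree, so for n ≥ 1 it
-- never wins and this is the minimum of the degrees.
minDegree : Graph n → ℕ
minDegree {n} G = min n (map (degree G) (allFin n))

-- A colour for each unordered edge: since T is proof-irrelevant, the colour
-- depends only on the pair {u, v}.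
record Colouring (r : ℕ) (G : Graph n) : Set where
  field
    colour    : ∀ {u v} → Adj G u v → Fin r
    symmetric : ∀ {u v} (e : Adj G u v) → colour e ≡ colour (flip G e)

open Colouring using (colour)

record Subgraph (G : Graph n) : Set where
  field
    vertices : Subset n
    edges    : Graph n
    edges⊆   : ∀ {u v} → Adj edges u v → Adj G u v
    ends∈    : ∀ {u v} → Adj edges u v → u ∈ vertices

open Subgraph using (vertices; edges; edges⊆; ends∈)

Connected : {G : Graph n} → Subgraph G → Set
Connected H = Nonempty (vertices H)
            × (∀ {u v} → u ∈ vertices H → v ∈ vertices H → Star (Adj (edges H)) u v)

-- No colour is named, so that an edgeless subgraph (a single vertex, when
-- connected) is monochromatic for every number of colours.
Monochromatic : {G : Graph n} → Colouring r G → Subgraph G → Set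
Monochromatic c H =
  ∀ {u v x y} (e : Adj (edges H) u v) (f : Adj (edges H) x y) →
  colour c (edges⊆ H e) ≡ colour c (edges⊆ H f)

record MonoConnectedSubgraph {G : Graph n} (c : Colouring r G) : Set where
  field
    subgraph      : Subgraph G
    monochromatic : Monochromatic c subgraph
    connected     : Connected subgraph

  open Subgraph subgraph public using () renaming (vertices to support)

open MonoConnectedSubgraph using (support)

CoveredBy≤ : {G : Graph n} → Colouring r G → ℕ → Set
CoveredBy≤ {n = n} c s =
  Σ (List (MonoConnectedSubgraph c)) λ Hs →
    length Hs ≤ s × (∀ v → Any (λ H → v ∈ support H) Hs)

TreeCoverable : (r : ℕ) → Graph n → ℕ → Set
TreeCoverable r G s = (c : Colouring r G) → CoveredBy≤ c s

IsMinimum : (ℕ → Set) → ℕ → Set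
IsMinimum P s = P s × (∀ t → P t → s ≤ t)

-- The private part shows that TreeCoverable r G s is decidable and holds for
-- s = n, so that the minimum defining the tree-cover number exists.

private

  Searchable : Set → Set₁
  Searchable A = {P : A → Set} → (∀ x → Dec (P x)) → Dec (∃ P)

  searchMaybe : ∀ {A} → Searchable A → Searchable (Maybe A)
  searchMaybe s P? = map′
    [ (λ p → nothing , p) , (λ (x , p) → just x , p) ]′
    (λ { (nothing , p) → inj₁ p ; (just x , p) → inj₂ (x , p) })
    (P? nothing ⊎-dec s (P? ∘ just))

  searchVec : ∀ {A} → Searchable A → ∀ m → Searchable (Vec A m)
  searchVec s zero    P? = map′ (λ p → [] , p) (λ { ([] , p) → p }) (P? [])
  searchVec s (suc m) P? = map′
    (λ (x , xs , p) → x ∷ xs , p)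
    (λ { (x ∷ xs , p) → x , xs , p })
    (s λ x → searchVec s m λ xs → P? (x ∷ xs))

  -- Reachability is decided as in the Floyd–Warshall algorithm: Via ks u v says
  -- that v can be reached from u through intermediate vertices in ks.
  module Reachability {n : ℕ} (R : Fin n → Fin n → Set) (R? : ∀ u v → Dec (R u v)) where

    Via : List (Fin n) → Fin n → Fin n → Set
    Via []       u v = u ≡ v ⊎ R u v
    Via (k ∷ ks) u v = Via ks u v ⊎ (Via ks u k × Via ks k v)

    via? : ∀ ks u v → Dec (Via ks u v)
    via? []       u v = (u Fin.≟ v) ⊎-dec R? u v
    via? (k ∷ ks) u v = via? ks u v ⊎-dec (via? ks u k ×-dec via? ks k v)

    via⇒star : ∀ ks {u v} → Via ks u v → Star R u v
    via⇒star []       (inj₁ refl)    = ε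
    via⇒star []       (inj₂ e)       = e ◅ ε
    via⇒star (k ∷ ks) (inj₁ p)       = via⇒star ks p
    via⇒star (k ∷ ks) (inj₂ (p , q)) = via⇒star ks p ◅◅ via⇒star ks q

    base : ∀ ks {u v} → u ≡ v ⊎ R u v → Via ks u v
    base []       p = p
    base (k ∷ ks) p = inj₁ (base ks p)

    through : ∀ ks {m u v} → m ∈ˡ ks → Via ks u m → Via ks m v → Via ks u v
    through (k ∷ ks) (here refl) p q =
      inj₂ ([ id , proj₁ ]′ p , [ id , proj₂ ]′ q)
    through (k ∷ ks) (there i) (inj₁ p) (inj₁ q) = inj₁ (through ks i p q)
    through (k ∷ ks) (there i) (inj₁ p) (inj₂ (q , q′)) = inj₂ (through ks i p q , q′)
    through (k ∷ ks) (there i) (inj₂ (p , p′)) (inj₁ q) = inj₂ (p , through ks i p′ q)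
    through (k ∷ ks) (there i) (inj₂ (p , _)) (inj₂ (_ , q)) = inj₂ (p , q)

    star⇒via : ∀ {u v} → Star R u v → Via (allFin n) u v
    star⇒via ε        = base (allFin n) (inj₁ refl)
    star⇒via (e ◅ es) =
      through (allFin n) (∈-allFin _) (base (allFin n) (inj₂ e)) (star⇒via es)

    star? : ∀ u v → Dec (Star R u v)
    star? u v = map′ (via⇒star (allFin n)) star⇒via (via? (allFin n) u v)

  module _ {n r : ℕ} {G : Graph n} (c : Colouring r G) where

    colour-flip : ∀ {u v} (e : Adj G u v) (f : Adj G v u) → colour c e ≡ colour c f
    colour-flip e f =
      trans (Colouring.symmetric c e) (cong (colour c) (T-irrelevant (flip G e) f))

    -- Edges inside S of colour j; none if j = nothing.
    Coloured : Subset n → Maybe (Fin r) → Fin n → Fin n → Set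
    Coloured S j u v =
      (u ∈ S × v ∈ S) × Σ (Adj G u v) λ e → just (colour c e) ≡ j

    coloured? : ∀ S j u v → Dec (Coloured S j u v)
    coloured? S j u v = (u ∈? S ×-dec v ∈? S) ×-dec edge?
      where
      edge? : Dec (Σ (Adj G u v) λ e → just (colour c e) ≡ j)
      edge? with T? (Graph.adj G u v)
      ... | no ¬e = no (¬e ∘ proj₁)
      ... | yes e = map′ (e ,_)
        (λ (f , q) → subst (λ g → just (colour c g) ≡ j) (T-irrelevant f e) q)
        (≡-dec Fin._≟_ (just (colour c e)) j)

    coloured-sym : ∀ {S j u v} → Coloured S j u v → Coloured S j v u
    coloured-sym ((p , q) , e , eq) =
      (q , p) , flip G e , trans (cong just (sym (Colouring.symmetric c e))) eq

    Linked : Subset n → Maybe (Fin r) → Set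
    Linked S j = ∀ u v → u ∈ S → v ∈ S → Star (Coloured S j) u v

    linked? : ∀ S j → Dec (Linked S j)
    linked? S j = all? λ u → all? λ v → (u ∈? S) →-dec ((v ∈? S) →-dec
      Reachability.star? (Coloured S j) (coloured? S j) u v)

    Good : Subset n → Set
    Good S = Nonempty S × ∃ (Linked S)

    good? : ∀ S → Dec (Good S)
    good? S = nonempty? S ×-dec searchMaybe any? (linked? S)

    fromGood : ∀ {S} → Good S → Σ (MonoConnectedSubgraph c) λ H → support H ≡ S
    fromGood {S} (ne , j , link) = record
      { subgraph = H
      ; monochromatic = λ e f → just-injective (trans (col e) (sym (col f)))
      ; connected = ne , λ p q → Star.map fromWitness (link _ _ p q)
      } , refl
      where
      R? = coloured? S j
      bool-sym : ∀ u v → isYes (R? u v) ≡ isYes (R? v u)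
      bool-sym u v with R? u v | R? v u
      ... | yes _ | yes _ = refl
      ... | no  _ | no  _ = refl
      ... | yes p | no ¬q = ⊥-elim (¬q (coloured-sym p))
      ... | no ¬p | yes q = ⊥-elim (¬p (coloured-sym q))
      bool-loop : ∀ v → isYes (R? v v) ≡ false
      bool-loop v with R? v v
      ... | no _ = refl
      ... | yes (_ , e , _) = ⊥-elim (subst T (Graph.loopless G v) e)
      H : Subgraph G
      H = record
        { vertices = S
        ; edges = record
          { adj = λ u v → isYes (R? u v) ; symmetric = bool-sym ; loopless = bool-loop }
        ; edges⊆ = λ e → proj₁ (proj₂ (toWitness e))
        ; ends∈ = λ e → proj₁ (proj₁ (toWitness e))
        }
      col : ∀ {u v} (e : Adj (edges H) u v) → just (colour c (edges⊆ H e)) ≡ j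
      col e = proj₂ (proj₂ (toWitness e))

    toGood : (H : MonoConnectedSubgraph c) → Good (support H)
    toGood record { subgraph = H ; monochromatic = mono ; connected = ne , conn }
      with any? (λ x → any? λ y → T? (Graph.adj (edges H) x y))
    ... | yes (x , y , f) = ne , just (colour c (edges⊆ H f)) , λ u v p q →
      Star.map (λ e → (ends∈ H e , ends∈ H (flip (edges H) e))
                    , edges⊆ H e , cong just (mono e f)) (conn p q)
    ... | no ¬f = ne , nothing , λ u v p q →
      Star.map (λ e → ⊥-elim (¬f (_ , _ , e))) (conn p q)

    -- Covering the complement of U by at most s subgraphs.
    Covers : ℕ → Subset n → Set
    Covers s U = Σ (List (MonoConnectedSubgraph c)) λ Hs →
      length Hs ≤ s × (∀ v → v ∈ U ⊎ Any (λ H → v ∈ support H) Hs)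

    covers? : ∀ s U → Dec (Covers s U)
    covers? zero U = map′
      (λ all → [] , z≤n , λ v → inj₁ (all v))
      (λ { ([] , _ , cov) v → [ id , (λ ()) ]′ (cov v) ; (_ ∷ _ , () , _) })
      (all? (_∈? U))
    covers? (suc s) U = map′ to from
      (all? (_∈? U) ⊎-dec anySubset? λ S → good? S ×-dec covers? s (U ∪ S))
      where
      to : (∀ v → v ∈ U) ⊎ (∃ λ S → Good S × Covers s (U ∪ S)) → Covers (suc s) U
      to (inj₁ all) = [] , z≤n , inj₁ ∘ all
      to (inj₂ (S , g , Hs , len , cov)) with fromGood g
      ... | H , refl = H ∷ Hs , s≤s len , λ v → case cov v of λ where
        (inj₂ i) → inj₂ (there i)
        (inj₁ i) → [ inj₁ , inj₂ ∘ here ]′ (x∈p∪q⁻ U S i)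
      from : Covers (suc s) U → (∀ v → v ∈ U) ⊎ (∃ λ S → Good S × Covers s (U ∪ S))
      from ([] , _ , cov) = inj₁ λ v → [ id , (λ ()) ]′ (cov v)
      from (H ∷ Hs , s≤s len , cov) = inj₂ (support H , toGood H , Hs , len , λ v →
        case cov v of λ where
          (inj₁ i)         → inj₁ (x∈p∪q⁺ (inj₁ i))
          (inj₂ (here i))  → inj₁ (x∈p∪q⁺ (inj₂ i))
          (inj₂ (there i)) → inj₂ i)

    coveredBy≤? : ∀ s → Dec (CoveredBy≤ c s)
    coveredBy≤? s = map′
      (λ (Hs , len , cov) → Hs , len , λ v → [ (λ i → contradiction i ∉⊥) , id ]′ (cov v))
      (λ (Hs , len , cov) → Hs , len , inj₂ ∘ cov)
      (covers? s ∅)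

    singletons : CoveredBy≤ c n
    singletons =
      map single (allFin n) ,
      ≤-reflexive (trans (length-map single (allFin n)) (length-tabulate id)) ,
      λ v → map⁺ (Any.map (λ { refl → support-single v }) (∈-allFin v))
      where
      good : ∀ v → Good ⁅ v ⁆
      good v = (v , x∈⁅x⁆ v) , nothing , λ x y p q →
        subst (Star (Coloured ⁅ v ⁆ nothing) x) (trans (x∈⁅y⁆⇒x≡y v p) (sym (x∈⁅y⁆⇒x≡y v q))) ε
      single : Fin n → MonoConnectedSubgraph c
      single v = proj₁ (fromGood (good v))
      support-single : ∀ v → v ∈ support (single v)
      support-single v = x∈⁅x⁆ v

  module _ {n r : ℕ} (G : Graph n) where

    recolour : {c d : Colouring r G} →
               (∀ {u v} (e : Adj G u v) → colour c e ≡ colour d e) →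
               ∀ {s} → CoveredBy≤ c s → CoveredBy≤ d s
    recolour {c} {d} eq (Hs , len , cov) =
      map f Hs , subst (_≤ _) (sym (length-map f Hs)) len , λ v → map⁺ (cov v)
      where
      f : MonoConnectedSubgraph c → MonoConnectedSubgraph d
      f H = record
        { subgraph = subgraph
        ; monochromatic = λ e f → trans (sym (eq _)) (trans (monochromatic e f) (eq _))
        ; connected = connected
        } where open MonoConnectedSubgraph H

    Table : Set
    Table = Vec (Vec (Maybe (Fin r)) n) n

    _at_,_ : Table → Fin n → Fin n → Maybe (Fin r)
    t at u , v = lookup (lookup t u) v

    Agrees : Table → Colouring r G → Set
    Agrees t c = ∀ {u v} (e : Adj G u v) → (t at u , v) ≡ just (colour c e)

    Valid : Table → Set
    Valid t = ∀ u v → Adj G u v →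
      (∃ λ i → (t at u , v) ≡ just i) × (t at u , v) ≡ (t at v , u)

    valid? : ∀ t → Dec (Valid t)
    valid? t = all? λ u → all? λ v → T? (Graph.adj G u v) →-dec
      (any? (λ i → ≡-dec Fin._≟_ (t at u , v) (just i))
        ×-dec ≡-dec Fin._≟_ (t at u , v) (t at v , u))

    agrees⇒valid : ∀ t c → Agrees t c → Valid t
    agrees⇒valid t c a u v e =
      (colour c e , a e) ,
      trans (a e) (trans (cong just (Colouring.symmetric c e)) (sym (a (flip G e))))

    fromTable : ∀ t → Valid t → Σ (Colouring r G) (Agrees t)
    fromTable t ok = record
      { colour = λ e → proj₁ (proj₁ (ok _ _ e))
      ; symmetric = λ e → just-injective
          (trans (sym (ag e)) (trans (proj₂ (ok _ _ e)) (ag (flip G e))))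
      } , ag
      where
      ag : ∀ {u v} (e : Adj G u v) → (t at u , v) ≡ just (proj₁ (proj₁ (ok u v e)))
      ag e = proj₂ (proj₁ (ok _ _ e))

    toTable : (c : Colouring r G) → ∃ λ t → Agrees t c
    toTable c = tabulate (λ u → tabulate (entry u)) , λ {u} {v} e →
      trans (cong (λ w → lookup w v) (lookup∘tabulate (λ x → tabulate (entry x)) u))
            (trans (lookup∘tabulate (entry u) v) (entry≡ e))
      where
      entry : Fin n → Fin n → Maybe (Fin r)
      entry u v with T? (Graph.adj G u v)
      ... | yes e = just (colour c e)
      ... | no  _ = nothing
      entry≡ : ∀ {u v} (e : Adj G u v) → entry u v ≡ just (colour c e)
      entry≡ {u} {v} e with T? (Graph.adj G u v)
      ... | yes f = cong (λ g → just (colour c g)) (T-irrelevant f e)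
      ... | no ¬f = contradiction e ¬f

    treeCoverable? : ∀ s → Dec (TreeCoverable r G s)
    treeCoverable? s = map′ to from
      (¬? (searchVec (searchVec (searchMaybe any?) n) n bad?))
      where
      Bad : Table → Set
      Bad t = ∃ λ c → Agrees t c × ¬ CoveredBy≤ c s
      to : ¬ ∃ Bad → TreeCoverable r G s
      to none c with toTable c
      ... | t , a = decidable-stable (coveredBy≤? c s) λ bad → none (t , c , a , bad)
      from : TreeCoverable r G s → ¬ ∃ Bad
      from all (_ , c , _ , bad) = bad (all c)
      bad? : ∀ t → Dec (Bad t)
      bad? t with valid? t
      ... | no ¬ok = no λ (c , a , _) → ¬ok (agrees⇒valid t c a)
      ... | yes ok with fromTable t ok
      ...   | c , a with coveredBy≤? c s
      ...     | no ¬cov = yes (c , a , ¬cov)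
      ...     | yes cov = no λ (d , b , ¬cov) →
        ¬cov (recolour (λ e → just-injective (trans (sym (a e)) (b e))) cov)

  minimum : {P : ℕ → Set} → (∀ s → Dec (P s)) → ∀ m → P m → ∃ (IsMinimum P)
  minimum P? zero    p = zero , p , λ _ _ → z≤n
  minimum P? (suc m) p with P? zero
  ... | yes p₀ = zero , p₀ , λ _ _ → z≤n
  ... | no ¬p₀ with minimum (P? ∘ suc) m p
  ...   | s , q , least = suc s , q , λ where
    zero    p₀ → contradiction p₀ ¬p₀
    (suc t) pt → s≤s (least t pt)

treeCoverNumber : ∀ r (G : Graph n) → ∃ (IsMinimum (TreeCoverable r G))
treeCoverNumber {n} r G = minimum (treeCoverable? G) n singletons

tc : ℕ → Graph n → ℕ
tc r G = proj₁ (treeCoverNumber r G)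

tc-isMinimum : ∀ r (G : Graph n) → IsMinimum (TreeCoverable r G) (tc r G)
tc-isMinimum r G = proj₂ (treeCoverNumber r G)

{-# OPTIONS --safe #-}

-- View each vertex of G as an edge joining its red component to its blue one, in
-- a bipartite multigraph on the components.  Components covering G then form a
-- vertex cover of that multigraph.  By König's theorem two
-- components suffice unless there are three vertices in pairwise different
-- components of both colours.  These are pairwise non-adjacent, so their
-- neighbourhoods lie among n − 3 vertices, while their degrees sum to at least
-- 2n − 5 > 2(n − 3).  Hence they have a common neighbour, and two of its three
-- edges to them share a colour, a contradiction.
module Submission where

open import Data.Nat using (ℕ; _+_; _*_; _≤_; _≥_)
open import Defs

open import Data.Bool.Base using (T)
open import Data.Bool.Properties using (T?; T-irrelevant; T-≡)
open import Data.Empty using (⊥)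
open import Data.Fin.Base using (Fin; zero)
open import Data.Fin.Patterns using (0F; 1F)
open import Data.Fin.Properties using (_≟_; any?; all?; ¬∀⟶∃¬)
open import Data.Fin.Subset
  using (Subset; inside; outside; ∣_∣; _∈_; _∉_; _⊃_; _∩_; _∪_; ⁅_⁆)
open import Data.Fin.Subset.Induction using (Acc; acc; ⊃-wellFounded)
open import Data.Fin.Subset.Properties
  using (_∈?_; x∈⁅x⁆; x∈⁅y⁆⇒x≡y; p⊆p∪q; q⊆p∪q; x∈p∪q⁻; x∈p∩q⁻;
         Empty-unique; ∣⊥∣≡0; ∣⁅x⁆∣≡1; ∣p∣≤n)
open import Data.List.Base using ([]; _∷_; map; allFin)
open import Data.List.Extrema.Nat using (min≤v⁺)
open import Data.List.Membership.Propositional.Properties using (∈-allFin)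
open import Data.List.Relation.Unary.Any as Any using (here; there)
open import Data.List.Relation.Unary.Any.Properties using (map⁺)
open import Data.Nat.Base using (suc; s≤s)
open import Data.Nat.Properties
  using (+-suc; +-mono-≤; +-identityʳ; ≤-refl; m+1+n≰m; module ≤-Reasoning)
open import Data.Nat.Solver using (module +-*-Solver)
open import Data.Product.Base using (Σ; ∃; ∃₂; _×_; _,_; proj₁; proj₂; map₂)
open import Data.Sum.Base using (_⊎_; inj₁; inj₂; [_,_]′)
open import Data.Vec.Base using ([]; _∷_)
open import Data.Vec.Properties using (lookup∘tabulate; []=⇒lookup)
open import Function.Base using (_∘_)
open import Function.Bundles using (_⇔_; mk⇔; Equivalence)
open import Relation.Binary.Construct.Closure.ReflexiveTransitive as Star
  using (Star; ε; _◅_; _◅◅_)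
open import Relation.Binary.Definitions using (Decidable; Symmetric)
open import Relation.Binary.Structures using (IsDecEquivalence)
open import Relation.Binary.PropositionalEquality
  using (_≡_; _≢_; refl; sym; trans; cong; cong₂; subst)
open import Relation.Nullary using (Dec; yes; no; ¬_)
open import Relation.Nullary.Decidable
  using (map′; _×-dec_; _⊎-dec_; ¬?; decidable-stable; isYes; isYes≗does; does-⇔; dec-false;
         toWitness; fromWitness)

private
  variable
    n : ℕ

-- Cardinalities of finite sets.

∣p∪q∣+∣p∩q∣≡∣p∣+∣q∣ : ∀ (p q : Subset n) → ∣ p ∪ q ∣ + ∣ p ∩ q ∣ ≡ ∣ p ∣ + ∣ q ∣
∣p∪q∣+∣p∩q∣≡∣p∣+∣q∣ []            []            = refl
∣p∪q∣+∣p∩q∣≡∣p∣+∣q∣ (outside ∷ p) (outside ∷ q) = ∣p∪q∣+∣p∩q∣≡∣p∣+∣q∣ p q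
∣p∪q∣+∣p∩q∣≡∣p∣+∣q∣ (inside  ∷ p) (outside ∷ q) = cong suc (∣p∪q∣+∣p∩q∣≡∣p∣+∣q∣ p q)
∣p∪q∣+∣p∩q∣≡∣p∣+∣q∣ (outside ∷ p) (inside  ∷ q) =
  trans (cong suc (∣p∪q∣+∣p∩q∣≡∣p∣+∣q∣ p q)) (sym (+-suc ∣ p ∣ ∣ q ∣))
∣p∪q∣+∣p∩q∣≡∣p∣+∣q∣ (inside  ∷ p) (inside  ∷ q) = cong suc
  (trans (+-suc ∣ p ∪ q ∣ ∣ p ∩ q ∣)
         (trans (cong suc (∣p∪q∣+∣p∩q∣≡∣p∣+∣q∣ p q)) (sym (+-suc ∣ p ∣ ∣ q ∣))))

Disjoint : Subset n → Subset n → Set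
Disjoint p q = ∀ {x} → x ∈ p → x ∉ q

∣p∪q∣≡∣p∣+∣q∣ : ∀ (p q : Subset n) → Disjoint p q → ∣ p ∪ q ∣ ≡ ∣ p ∣ + ∣ q ∣
∣p∪q∣≡∣p∣+∣q∣ {n} p q disj = trans (sym (+-identityʳ _)) (trans
  (cong (∣ p ∪ q ∣ +_) (sym ∣p∩q∣≡0))
  (∣p∪q∣+∣p∩q∣≡∣p∣+∣q∣ p q))
  where
  ∣p∩q∣≡0 : ∣ p ∩ q ∣ ≡ 0
  ∣p∩q∣≡0 = trans
    (cong ∣_∣ (Empty-unique λ (x , x∈) → let x∈p , x∈q = x∈p∩q⁻ p q x∈ in disj x∈p x∈q))
    (∣⊥∣≡0 n)

disjoint-∪ : ∀ (p q : Subset n) {s} → Disjoint p s → Disjoint q s → Disjoint (p ∪ q) s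
disjoint-∪ p q p∌ q∌ x∈ = [ p∌ , q∌ ]′ (x∈p∪q⁻ p q x∈)

-- Outside s every point is counted at most twice.
three-sets-bound : ∀ (p q r s : Subset n) →
  (∀ {x} → x ∈ p → x ∈ q → x ∉ r) →
  Disjoint p s → Disjoint q s → Disjoint r s →
  ∣ p ∣ + ∣ q ∣ + ∣ r ∣ + (∣ s ∣ + ∣ s ∣) ≤ n + n
three-sets-bound {n} p q r s pqr ps qs rs = begin
  ∣ p ∣ + ∣ q ∣ + ∣ r ∣ + (∣ s ∣ + ∣ s ∣)
    ≡⟨ cong (λ k → k + ∣ r ∣ + (∣ s ∣ + ∣ s ∣)) (sym (∣p∪q∣+∣p∩q∣≡∣p∣+∣q∣ p q)) ⟩
  ∣ p ∪ q ∣ + ∣ p ∩ q ∣ + ∣ r ∣ + (∣ s ∣ + ∣ s ∣)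
    -- A point of exactly one of `p`, `q`, `r` is counted in `p ∪ q` or in `p ∩ q ∪ r`, a point of
    -- two of them in both. Each of these sets is disjoint from `s`, so joining `s` to each gives
    -- two sets of size at most `n`.
    ≡⟨ solve 4 (λ a b c d → a :+ b :+ c :+ (d :+ d) := (a :+ d) :+ ((b :+ c) :+ d)) refl
         (∣ p ∪ q ∣) (∣ p ∩ q ∣) (∣ r ∣) (∣ s ∣) ⟩
  (∣ p ∪ q ∣ + ∣ s ∣) + ((∣ p ∩ q ∣ + ∣ r ∣) + ∣ s ∣)
    ≡⟨ cong₂ _+_
         (sym (∣p∪q∣≡∣p∣+∣q∣ (p ∪ q) s (disjoint-∪ p q ps qs)))
         (trans (cong (_+ ∣ s ∣) (sym (∣p∪q∣≡∣p∣+∣q∣ (p ∩ q) r pq-r)))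
                (sym (∣p∪q∣≡∣p∣+∣q∣ (p ∩ q ∪ r) s
                       (disjoint-∪ (p ∩ q) r (ps ∘ proj₁ ∘ x∈p∩q⁻ p q) rs)))) ⟩
  ∣ (p ∪ q) ∪ s ∣ + ∣ (p ∩ q ∪ r) ∪ s ∣
    ≤⟨ +-mono-≤ (∣p∣≤n ((p ∪ q) ∪ s)) (∣p∣≤n ((p ∩ q ∪ r) ∪ s)) ⟩
  n + n ∎
  where
  open ≤-Reasoning
  open +-*-Solver
  pq-r : Disjoint (p ∩ q) r
  pq-r x∈ = let x∈p , x∈q = x∈p∩q⁻ p q x∈ in pqr x∈p x∈q

distinct⇒disjoint : ∀ {u v : Fin n} → u ≢ v → Disjoint ⁅ u ⁆ ⁅ v ⁆
distinct⇒disjoint u≢v x∈u x∈v =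
  u≢v (trans (sym (x∈⁅y⁆⇒x≡y _ x∈u)) (x∈⁅y⁆⇒x≡y _ x∈v))

∣triple∣≡3 : ∀ {u v w : Fin n} → u ≢ v → v ≢ w → u ≢ w →
             ∣ (⁅ u ⁆ ∪ ⁅ v ⁆) ∪ ⁅ w ⁆ ∣ ≡ 3
∣triple∣≡3 {u = u} {v} {w} u≢v v≢w u≢w = trans
  (∣p∪q∣≡∣p∣+∣q∣ (⁅ u ⁆ ∪ ⁅ v ⁆) ⁅ w ⁆
    (disjoint-∪ ⁅ u ⁆ ⁅ v ⁆ (distinct⇒disjoint u≢w) (distinct⇒disjoint v≢w)))
  (cong₂ _+_
    (trans (∣p∪q∣≡∣p∣+∣q∣ ⁅ u ⁆ ⁅ v ⁆ (distinct⇒disjoint u≢v))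
           (cong₂ _+_ (∣⁅x⁆∣≡1 u) (∣⁅x⁆∣≡1 v)))
    (∣⁅x⁆∣≡1 w))

-- Neighbourhoods and the degree condition.

∈-neighbours⇒Adj : ∀ (G : Graph n) {u x} → x ∈ neighbours G u → Graph.Adj G u x
∈-neighbours⇒Adj G {u} {x} x∈ = Equivalence.from T-≡
  (trans (sym (lookup∘tabulate (Graph.adj G u) x)) ([]=⇒lookup x∈))

minDegree≤degree : ∀ (G : Graph n) v → minDegree G ≤ degree G v
minDegree≤degree {n} G v = min≤v⁺ n (map (degree G) (allFin n))
  -- `inj₂` bounds the minimum by an entry of the list, `inj₁` would use the default value `n`.
  (inj₂ (map⁺ (Any.map (λ { refl → ≤-refl }) (∈-allFin v))))

module _ (G : Graph n) where
  open Graph G using (Adj; adj; flip; loopless)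

  -- The degree bound is cleared of its denominator and its subtraction, so that it is exact over
  -- the naturals.
  common-neighbour : 3 * minDegree G + 5 ≥ 2 * n →
    ∀ {u v w} → u ≢ v → v ≢ w → u ≢ w → ¬ Adj u v → ¬ Adj v w → ¬ Adj u w →
    ∃ λ x → Adj u x × Adj v x × Adj w x
  common-neighbour large {u} {v} {w} u≢v v≢w u≢w u≁v v≁w u≁w =
    decidable-stable
      (any? λ x → T? (adj u x) ×-dec T? (adj v x) ×-dec T? (adj w x))
      -- Without a common neighbour the chain gives 3δ + 6 ≤ 2n ≤ 3δ + 5. The 6 is the size of the
      -- triple, counted twice.
      λ none → m+1+n≰m (3 * minDegree G + 5) (begin
        3 * minDegree G + 5 + 1
          ≡⟨ solve 1 (λ d → con 3 :* d :+ con 5 :+ con 1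
                              := d :+ d :+ d :+ (con 3 :+ con 3)) refl (minDegree G) ⟩
        minDegree G + minDegree G + minDegree G + (3 + 3)
          ≤⟨ +-mono-≤ (+-mono-≤ (+-mono-≤ (δ≤ u) (δ≤ v)) (δ≤ w)) ≤-refl ⟩
        degree G u + degree G v + degree G w + (3 + 3)
          ≡⟨ cong (λ k → degree G u + degree G v + degree G w + (k + k))
                  (sym (∣triple∣≡3 u≢v v≢w u≢w)) ⟩
        degree G u + degree G v + degree G w + (∣ s ∣ + ∣ s ∣)
          -- The triple is independent, so it avoids all three neighbourhoods.
          ≤⟨ three-sets-bound (neighbours G u) (neighbours G v) (neighbours G w) s
               (λ x∈u x∈v x∈w → none (_ , N x∈u , N x∈v , N x∈w))
               (λ x∈ → avoid (irrefl u) u≁v u≁w (N x∈))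
               (λ x∈ → avoid (u≁v ∘ flip) (irrefl v) v≁w (N x∈))
               (λ x∈ → avoid (u≁w ∘ flip) (v≁w ∘ flip) (irrefl w) (N x∈)) ⟩
        n + n
          ≡⟨ cong (n +_) (sym (+-identityʳ n)) ⟩
        2 * n
          ≤⟨ large ⟩
        3 * minDegree G + 5 ∎)
    where
    open ≤-Reasoning
    open +-*-Solver
    s = (⁅ u ⁆ ∪ ⁅ v ⁆) ∪ ⁅ w ⁆
    δ≤ = minDegree≤degree G
    N : ∀ {y x} → x ∈ neighbours G y → Adj y x
    N = ∈-neighbours⇒Adj G
    irrefl : ∀ y → ¬ Adj y y
    irrefl y = subst T (loopless y)
    avoid : ∀ {y} → ¬ Adj y u → ¬ Adj y v → ¬ Adj y w → ∀ {x} → Adj y x → x ∉ s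
    avoid y≁u y≁v y≁w e x∈ with x∈p∪q⁻ (⁅ u ⁆ ∪ ⁅ v ⁆) ⁅ w ⁆ x∈
    ... | inj₂ x∈w = y≁w (subst (Adj _) (x∈⁅y⁆⇒x≡y w x∈w) e)
    ... | inj₁ x∈uv with x∈p∪q⁻ ⁅ u ⁆ ⁅ v ⁆ x∈uv
    ...   | inj₁ x∈u = y≁u (subst (Adj _) (x∈⁅y⁆⇒x≡y u x∈u) e)
    ...   | inj₂ x∈v = y≁v (subst (Adj _) (x∈⁅y⁆⇒x≡y v x∈v) e)

-- Covering by two classes of two equivalence relations.

-- König's theorem for matching number two, a point x being the edge between its
-- R 0F-class and its R 1F-class.
module König {R : Fin 2 → Fin n → Fin n → Set}
             (isDecEq : ∀ i → IsDecEquivalence (R i)) where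

  private module R {i} = IsDecEquivalence (isDecEq i)

  -- Separate points are edges without a common endpoint, so pairwise separate points form a
  -- matching.
  Separate : Fin n → Fin n → Set
  Separate x y = ∀ i → ¬ R i x y

  separate? : ∀ x y → Dec (Separate x y)
  separate? x y = all? λ i → ¬? (x R.≟ y)

  module _ (no-three : ∀ {x y z} → Separate x y → Separate y z → Separate x z → ⊥) where

    private
      apart : ∀ {i a x y} → R i a x → ¬ R i a y → ¬ R i x y
      apart ax a≁y xy = a≁y (R.trans ax xy)

      apart′ : ∀ {i a x y} → ¬ R i a x → R i a y → ¬ R i x y
      apart′ a≁x ay xy = a≁x (R.trans ay (R.sym xy))

      separate : ∀ {x y} → ¬ R 0F x y → ¬ R 1F x y → Separate x y
      separate p q 0F = p
      separate p q 1F = q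

    -- The augmenting path x – u – y.
    no-short-path : ∀ {u v x y} → Separate u v →
      R 1F u x → ¬ R 0F u x → ¬ R 0F v x →
      R 0F u y → ¬ R 1F u y → ¬ R 1F v y → ⊥
    -- Augmenting replaces the matching `u`, `v` by `x`, `y`, `v`.
    no-short-path uv Bux ¬Aux ¬Avx Auy ¬Buy ¬Bvy = no-three
      (separate (apart′ ¬Aux Auy) (apart Bux ¬Buy))
      (separate (apart Auy (uv 0F)) (¬Bvy ∘ R.sym))
      (separate (¬Avx ∘ R.sym) (apart Bux (uv 1F)))

    -- The augmenting path x – u – z – v – y, unless it has a shortcut.
    no-long-path : ∀ {u v x y z} → Separate u v →
      R 1F u x → ¬ R 0F u x → ¬ R 0F v x →
      R 0F v y → ¬ R 1F u y → ¬ R 1F v y →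
      ¬ R 1F u z → ¬ R 0F v z → ⊥
    no-long-path {u} {v} {z = z} uv Bux ¬Aux ¬Avx Avy ¬Buy ¬Bvy ¬Buz ¬Avz
      with u R.≟ z | v R.≟ z
    -- Here `z` meets both `u` and `v`, and augmenting replaces `u`, `v` by `x`, `z`, `y`.
    ... | yes Auz | yes Bvz = no-three
      (separate (apart′ ¬Aux Auz) (apart Bux ¬Buz))
      (separate (apart′ ¬Avz Avy) (apart Bvz ¬Bvy))
      (separate (apart′ ¬Avx Avy) (apart Bux ¬Buy))
    -- If `z` meets only one of `u`, `v`, then x - u - z or z - v - y is already augmenting. If it
    -- meets neither, `u`, `v`, `z` is a matching.
    ... | yes Auz | no ¬Bvz = no-short-path uv Bux ¬Aux ¬Avx Auz ¬Buz ¬Bvz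
    ... | no ¬Auz | yes Bvz =
      no-short-path (λ i → uv i ∘ R.sym) Bvz ¬Avz ¬Auz Avy ¬Bvy ¬Buy
    ... | no ¬Auz | no ¬Bvz = no-three uv (separate ¬Avz ¬Bvz) (separate ¬Auz ¬Buz)

    -- The indices choose one endpoint of `u` and one of `v` for the vertex cover.
    Cover : Fin n → Fin n → Fin 2 → Fin 2 → Set
    Cover u v i j = ∀ x → R i u x ⊎ R j v x

    cover? : ∀ u v i j → Dec (Cover u v i j)
    cover? u v i j = all? λ x → (u R.≟ x) ⊎-dec (v R.≟ x)

    missed : ∀ {u v i j} → ¬ Cover u v i j → ∃ λ x → ¬ R i u x × ¬ R j v x
    missed {u} {v} {i} {j} ¬cov =
      map₂ (λ ¬p → ¬p ∘ inj₁ , ¬p ∘ inj₂)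
           (¬∀⟶∃¬ _ _ (λ x → (u R.≟ x) ⊎-dec (v R.≟ x)) ¬cov)

    -- A cover must take an endpoint of each of `u` and `v`. If all four choices fail, the four
    -- points they miss yield an augmenting path.
    separate⇒cover : ∀ {u v} → Separate u v → ∃₂ (Cover u v)
    separate⇒cover {u} {v} uv =
      decidable-stable (any? λ i → any? λ j → cover? u v i j) λ none →
        let uncovered = λ i j → missed {u} {v} {i} {j} λ cov → none (i , j , cov)
            x , ¬Aux , ¬Avx = uncovered 0F 0F
            y , ¬Buy , ¬Bvy = uncovered 1F 1F
            z , ¬Auz , ¬Bvz = uncovered 0F 1F
            t , ¬But , ¬Avt = uncovered 1F 0F
        in  not-all-uncovered uv (λ i → uv i ∘ R.sym) x y
              ¬Aux ¬Avx ¬Buy ¬Bvy ¬Auz ¬Bvz ¬But ¬Avt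
      where
      not-all-uncovered : Separate u v → Separate v u → ∀ x y {z t} →
        ¬ R 0F u x → ¬ R 0F v x → ¬ R 1F u y → ¬ R 1F v y →
        ¬ R 0F u z → ¬ R 1F v z → ¬ R 1F u t → ¬ R 0F v t → ⊥
      -- By `no-three`, `x` meets `u` or `v` in its 1F-class, and `y` meets one of them in its
      -- 0F-class. If both meet the same one, the path is short; otherwise `t` or `z` is the middle
      -- of a long one.
      not-all-uncovered uv vu x y ¬Aux ¬Avx ¬Buy ¬Bvy ¬Auz ¬Bvz ¬But ¬Avt
        with u R.≟ x | v R.≟ x | u R.≟ y | v R.≟ y
      ... | yes Bux | _ | yes Auy | _ = no-short-path uv Bux ¬Aux ¬Avx Auy ¬Buy ¬Bvy
      ... | yes Bux | _ | no _ | yes Avy =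
        no-long-path uv Bux ¬Aux ¬Avx Avy ¬Buy ¬Bvy ¬But ¬Avt
      ... | no _ | yes Bvx | _ | yes Avy = no-short-path vu Bvx ¬Avx ¬Aux Avy ¬Bvy ¬Buy
      ... | no _ | yes Bvx | yes Auy | no _ =
        no-long-path vu Bvx ¬Avx ¬Aux Auy ¬Bvy ¬Buy ¬Bvz ¬Auz
      ... | no ¬Bux | no ¬Bvx | _ | _ =
        no-three uv (separate ¬Avx ¬Bvx) (separate ¬Aux ¬Bux)
      ... | _ | _ | no ¬Auy | no ¬Avy =
        no-three uv (separate ¬Avy ¬Bvy) (separate ¬Auy ¬Buy)

    two-classes-cover : Fin n → ∃₂ λ u v → ∃₂ (Cover u v)
    two-classes-cover u with any? (separate? u)
    ... | yes (v , uv) = u , v , separate⇒cover uv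
    -- Every point shares a class with `u`, so the two endpoints of `u` form a cover.
    ... | no none = u , u , 0F , 1F , λ x →
      decidable-stable ((u R.≟ x) ⊎-dec (u R.≟ x)) λ ¬p →
        none (x , separate (¬p ∘ inj₁) (¬p ∘ inj₂))

-- Reachable sets by exhaustive search.

module _ {R : Fin n → Fin n → Set} (R? : Decidable R) (u : Fin n) where

  private
    Reached : Subset n → Set
    Reached S = ∀ {v} → v ∈ S → Star R u v

    -- Each round adds a point one step outside `S`. A strictly growing subset of a finite set must
    -- stop, and then no path leaves it.
    grow : ∀ S → Acc _⊃_ S → u ∈ S → Reached S →
           ∃ λ C → ∀ {v} → v ∈ C ⇔ Star R u v
    grow S (acc rec) u∈S reached
      with any? (λ x → any? λ y → x ∈? S ×-dec ¬? (y ∈? S) ×-dec R? x y)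
    ... | yes (x , y , x∈S , y∉S , xRy) =
      grow (S ∪ ⁅ y ⁆)
        (rec (p⊆p∪q ⁅ y ⁆ , y , q⊆p∪q S ⁅ y ⁆ (x∈⁅x⁆ y) , y∉S))
        (p⊆p∪q ⁅ y ⁆ u∈S)
        ([ reached
         , (λ v∈ → subst (Star R u) (sym (x∈⁅y⁆⇒x≡y y v∈)) (reached x∈S ◅◅ xRy ◅ ε)) ]′
         ∘ x∈p∪q⁻ S ⁅ y ⁆)
    ... | no closed = S , mk⇔ reached (stay u∈S)
      where
      stay : ∀ {x v} → x ∈ S → Star R x v → v ∈ S
      stay x∈S ε = x∈S
      stay x∈S (_◅_ {j = y} xRy p) =
        stay (decidable-stable (y ∈? S) λ y∉S → closed (_ , y , x∈S , y∉S , xRy)) p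

  reachable : ∃ λ C → ∀ {v} → v ∈ C ⇔ Star R u v
  reachable = grow ⁅ u ⁆ (⊃-wellFounded _) (x∈⁅x⁆ u)
    λ v∈ → subst (Star R u) (sym (x∈⁅y⁆⇒x≡y u v∈)) ε

star-isDecEquivalence : {R : Fin n → Fin n → Set} → Decidable R → Symmetric R →
                        IsDecEquivalence (Star R)
star-isDecEquivalence R? R-sym = record
  { isEquivalence = record { refl = ε ; sym = Star.reverse R-sym ; trans = _◅◅_ }
  ; _≟_ = λ u v → let C , C⇔ = reachable R? u in
      map′ (Equivalence.to C⇔) (Equivalence.from C⇔) (v ∈? C)
  }

fromRelation : {R : Fin n → Fin n → Set} → Decidable R → Symmetric R →
               (∀ {v} → ¬ R v v) → Graph n
fromRelation R? R-sym R-irrefl = record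
  { adj = λ u v → isYes (R? u v)
  ; symmetric = λ u v → trans (isYes≗does (R? u v))
      (trans (does-⇔ (mk⇔ R-sym R-sym) (R? u v) (R? v u)) (sym (isYes≗does (R? v u))))
  ; loopless = λ v → trans (isYes≗does (R? v v)) (dec-false (R? v v) R-irrefl)
  }

-- Monochromatic components as subgraphs.

module _ {r : ℕ} {G : Graph n} (c : Colouring r G) where
  open Graph G using (Adj; adj; flip; loopless)
  open Colouring c using (colour) renaming (symmetric to colour-sym)

  Coloured : Fin r → Fin n → Fin n → Set
  Coloured i u v = Σ (Adj u v) λ e → colour e ≡ i

  coloured? : ∀ i → Decidable (Coloured i)
  coloured? i u v with T? (adj u v)
  ... | no ¬e = no (¬e ∘ proj₁)
  ... | yes e = map′ (e ,_)
    (λ (f , eq) → subst (λ g → colour g ≡ i) (T-irrelevant f e) eq) (colour e ≟ i)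

  coloured-sym : ∀ i → Symmetric (Coloured i)
  coloured-sym i (e , eq) = flip e , trans (sym (colour-sym e)) eq

  coloured-irrefl : ∀ i {v} → ¬ Coloured i v v
  coloured-irrefl i {v} (e , _) = subst T (loopless v) e

  SameComponent : Fin r → Fin n → Fin n → Set
  SameComponent i = Star (Coloured i)

  sameComponent-isDecEquivalence : ∀ i → IsDecEquivalence (SameComponent i)
  sameComponent-isDecEquivalence i = star-isDecEquivalence (coloured? i) (coloured-sym i)

  -- The inclusion turns a cover by classes into a cover by subgraphs. If `u` has no edge of colour
  -- `i`, the subgraph is a single vertex.
  component : ∀ i u → ∃ λ (H : MonoConnectedSubgraph c) →
              ∀ {v} → SameComponent i u v → v ∈ MonoConnectedSubgraph.support H
  component i u = record
    { subgraph = record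
      { vertices = C
      ; edges = fromRelation E? E-sym (coloured-irrefl i ∘ proj₂)
      ; edges⊆ = λ e → proj₁ (proj₂ (toWitness e))
      ; ends∈ = λ e → proj₁ (toWitness e)
      }
    ; monochromatic = λ e f →
        trans (proj₂ (proj₂ (toWitness e))) (sym (proj₂ (proj₂ (toWitness f))))
    ; connected = (u , from ε) , λ x∈C y∈C →
        within x∈C (Star.reverse (coloured-sym i) (to x∈C) ◅◅ to y∈C)
    } , from
    where
    C = proj₁ (reachable (coloured? i) u)
    to : ∀ {v} → v ∈ C → SameComponent i u v
    to = Equivalence.to (proj₂ (reachable (coloured? i) u))
    from : ∀ {v} → SameComponent i u v → v ∈ C
    from = Equivalence.from (proj₂ (reachable (coloured? i) u))
    next : ∀ {x y} → x ∈ C → Coloured i x y → y ∈ C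
    next x∈C e = from (to x∈C ◅◅ e ◅ ε)
    -- Since `C` is closed under edges of colour `i`, asking for one end in `C` puts both there,
    -- which makes `E` symmetric.
    E : Fin n → Fin n → Set
    E x y = x ∈ C × Coloured i x y
    E? : Decidable E
    E? x y = x ∈? C ×-dec coloured? i x y
    E-sym : Symmetric E
    E-sym (x∈C , e) = next x∈C e , coloured-sym i e
    within : ∀ {x y} → x ∈ C → SameComponent i x y →
             Star (λ x y → T (isYes (E? x y))) x y
    within x∈C ε = ε
    within x∈C (e ◅ p) = fromWitness (x∈C , e) ◅ within (next x∈C e) p

-- Two colours.

two-of-three-equal : (i j k : Fin 2) → i ≡ j ⊎ j ≡ k ⊎ i ≡ k
two-of-three-equal 0F 0F _  = inj₁ refl
two-of-three-equal 1F 1F _  = inj₁ refl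
two-of-three-equal 0F 1F 1F = inj₂ (inj₁ refl)
two-of-three-equal 1F 0F 0F = inj₂ (inj₁ refl)
two-of-three-equal 0F 1F 0F = inj₂ (inj₂ refl)
two-of-three-equal 1F 0F 1F = inj₂ (inj₂ refl)

module _ {G : Graph n} (c : Colouring 2 G) where
  open Graph G using (Adj; flip)
  open Colouring c using (colour)
  open König (sameComponent-isDecEquivalence c)

  separate⇒≢ : ∀ {u v} → Separate u v → u ≢ v
  separate⇒≢ uv refl = uv 0F ε

  separate⇒nonadjacent : ∀ {u v} → Separate u v → ¬ Adj u v
  separate⇒nonadjacent uv e = uv (colour e) ((e , refl) ◅ ε)

  -- The path u - x - v has a single colour and puts `u` and `v` in one component.
  equal-colours⇒¬separate : ∀ {u v x} (e : Adj u x) (f : Adj v x) →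
    colour e ≡ colour f → ¬ Separate u v
  equal-colours⇒¬separate e f eq uv =
    uv (colour f) ((e , eq) ◅ coloured-sym c _ (f , refl) ◅ ε)

  no-three-separate : 3 * minDegree G + 5 ≥ 2 * n →
    ∀ {u v w} → Separate u v → Separate v w → Separate u w → ⊥
  no-three-separate large uv vw uw
    with common-neighbour G large
           (separate⇒≢ uv) (separate⇒≢ vw) (separate⇒≢ uw)
           (separate⇒nonadjacent uv) (separate⇒nonadjacent vw) (separate⇒nonadjacent uw)
  ... | x , e , f , g with two-of-three-equal (colour e) (colour f) (colour g)
  ...   | inj₁ ef        = equal-colours⇒¬separate e f ef uv
  ...   | inj₂ (inj₁ fg) = equal-colours⇒¬separate f g fg vw
  ...   | inj₂ (inj₂ eg) = equal-colours⇒¬separate e g eg uw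

  components-cover : ∀ {i j u v} → (∀ x → SameComponent c i u x ⊎ SameComponent c j v x) →
                     CoveredBy≤ c 2
  components-cover {i} {j} {u} {v} cover =
    proj₁ (component c i u) ∷ proj₁ (component c j v) ∷ [] , ≤-refl , λ x →
      [ here ∘ proj₂ (component c i u) , there ∘ here ∘ proj₂ (component c j v) ]′ (cover x)

  covered-by-two : 3 * minDegree G + 5 ≥ 2 * n → Fin n → CoveredBy≤ c 2
  covered-by-two large v₀ =
    let _ , _ , _ , _ , cover = two-classes-cover (no-three-separate large) v₀
    in  components-cover cover

theorem4p6 : (n : ℕ) → n ≥ 1 → (G : Graph n) →
    3 * minDegree G + 5 ≥ 2 * n →
    tc 2 G ≤ 2
theorem4p6 (suc n) (s≤s _) G large =
  -- Minimality bounds `tc 2 G` by any number that suffices for every colouring. The vertex `zero`,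
  -- available as n ≥ 1, starts the search for the two classes.
  proj₂ (tc-isMinimum 2 G) 2 λ c → covered-by-two c large zero
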